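{- Let $G=(V,E,w)$ be an undirected graph with nonnegative edge weights and $n=|V|$, and let $k\in\mathbb{N}$. Then the set of values $\{\mathrm{mincut}_G(D): D\subseteq V\times V,\ |D|=k\}$ has size $O_k(n^{k})$; consequently the family of $k$-multicut instances has redundancy factor $\Omega_k(n^k)$. Furthermore, this bound is existentially tight: for all $n$ and $k$ there is a graph $G$ on $n$ vertices for which this set has size $\Omega_k(n^{k})$.
   Context: A partition of $V$ is a collection of pairwise disjoint subsets of $V$ whose union is $V$; for a partition $\Pi$ and $v\in V$, $\Pi(v)$ is the part containing $v$. For a partition $\Pi$, $\mathrm{cut}_G(\Pi)=\sum_{uv\in E:\,\Pi(u)\neq\Pi(v)} w(uv)$. A demand graph $D$ is a set of pairs of distinct vertices (demand pairs); a partition $\Pi$ agrees with $D$ if $\Pi(u)\ne\Pi(v)$ for every $(u,v)\in D$, and $\mathrm{mincut}_G(D)=\min\{\mathrm{cut}_G(\Pi): \Pi \text{ agrees with } D\}$ (the minimum weight of an edge set whose removal leaves no $u$–$v$ path for each $(u,v)\in D$). The redundancy factor of a family $\mathcal D$ of demand graphs is $|\mathcal D|$ divided by the number of distinct values in $\{\mathrm{mincut}_G(D):D\in\mathcal D\}$. $O_{k},\Omega_k$ hide factors depending only on $k$.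
   Formalization: Edge weights are nonnegative rationals instead of reals; the bounds are stated for all n beyond a threshold depending on k; the immediate consequence about the redundancy factor is not stated separately. -}

module Defs where

open import Data.Nat using (ℕ; zero; suc)
open import Data.Fin using (Fin; toℕ)
open import Data.Fin.Properties using () renaming (_≟_ to _≟F_)
open import Data.Nat.Properties using (_<?_)
open import Data.Rational using (ℚ; 0ℚ; _+_; _≤_)
open import Data.Bool using (Bool; true; false; if_then_else_; _∧_; not)
open import Data.Product using (_×_; _,_; Σ-syntax; ∃-syntax)
open import Data.List using (List; length)
open import Data.List.Relation.Unary.All using (All)
open import Data.List.Relation.Unary.Unique.Propositional using (Unique)
open import Relation.Nullary using (does)
open import Relation.Binary.PropositionalEquality using (_≡_; _≢_)

sumFin : {n : ℕ} → (Fin n → ℚ) → ℚ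
sumFin {zero}  f = 0ℚ
sumFin {suc n} f = f Fin.zero + sumFin (λ i → f (Fin.suc i))
  where import Data.Fin as Fin

-- An undirected weighted graph on vertex set Fin n: the weight of the
-- (unordered) edge {u,v}, u < v, is w u v (0 = no edge).  Only the entries
-- with toℕ u < toℕ v are ever read.
Weights : ℕ → Set
Weights n = Fin n → Fin n → ℚ

NonNeg : {n : ℕ} → Weights n → Set
NonNeg w = ∀ u v → 0ℚ ≤ w u v

-- A partition Π of Fin n is given by a labelling Π : Fin n → Fin n;
-- its parts are the nonempty fibres, so Π(u) = Π(v) iff the labels agree.
-- Every partition of an n-element set arises this way.
Partition : ℕ → Set
Partition n = Fin n → Fin n

cut : {n : ℕ} → Weights n → Partition n → ℚ
cut w Π = sumFin (λ u → sumFin (λ v →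
  if does (toℕ u <? toℕ v) ∧ not (does (Π u ≟F Π v)) then w u v else 0ℚ))

DemandGraph : ℕ → Set
DemandGraph n = List (Fin n × Fin n)

ValidDemand : {n : ℕ} → DemandGraph n → Set
ValidDemand D = Unique D × All (λ p → Data.Product.proj₁ p ≢ Data.Product.proj₂ p) D
  where import Data.Product

Agrees : {n : ℕ} → Partition n → DemandGraph n → Set
Agrees Π D = All (λ p → Π (Data.Product.proj₁ p) ≢ Π (Data.Product.proj₂ p)) D
  where import Data.Product

IsMincut : {n : ℕ} → Weights n → DemandGraph n → ℚ → Set
IsMincut w D c =
  (∃[ Π ] (Agrees Π D × cut w Π ≡ c)) ×
  (∀ Π → Agrees Π D → c ≤ cut w Π)

IsKMincutValue : {n : ℕ} → Weights n → ℕ → ℚ → Set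
IsKMincutValue w k c =
  ∃[ D ] (ValidDemand D × length D ≡ k × IsMincut w D c)

{-# OPTIONS --safe #-}
module Submission where

-- Upper bound: attach to a demand graph D the polynomial P_D = ∏_{uv ∈ D} (x_u − x_v), and evaluate it
-- at the labels of a partition Π, so that P_D(Π) ≠ 0 exactly when Π agrees with D.  Choose one D per
-- mincut value together with an optimal partition.  A partition cheaper than mincut(D) cannot agree
-- with D, so listing the values in decreasing order makes the matrix P_D(Π_{D′}) triangular with
-- nonzero diagonal.  The P_D live in a space of dimension n^k, hence there are at most n^k values.
--
-- Lower bound: in a star, separating a set S of leaves from the centre costs the total weight of S.
-- With leaf weights q m^j for q < m and j < k, base-m expansion realises every value below m^k.

open import Defs
open import Data.Nat using (ℕ; _≤_; _*_; _^_)
open import Data.Product using (_×_; Σ-syntax; ∃-syntax)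
open import Data.List using (List; length)
open import Data.List.Relation.Unary.All using (All)
open import Data.List.Relation.Unary.Unique.Propositional using (Unique)
open import Data.List.Membership.Propositional using (_∈_)
open import Data.Rational using (ℚ)
open import Algebra.Bundles using (CommutativeMonoid)
import Algebra.Properties.CommutativeSemigroup as CommutativeSemigroupProperties
import Algebra.Properties.Monoid.Mult as Mult
open import Data.Bool using (if_then_else_; _∧_; not)
open import Data.Bool.Properties using (if-eta)
open import Data.Fin using (Fin; zero; suc; toℕ; fromℕ<)
open import Data.Fin.Properties using (toℕ-injective; toℕ-fromℕ<) renaming (_≟_ to _≟F_)
open import Data.Integer as ℤ using (ℤ; +_; 0ℤ; 1ℤ)
import Data.Integer.Properties as ℤ
open import Data.Integer.Tactic.RingSolver using (solve-∀)
open import Data.List using ([]; _∷_; map; filter; foldr; upTo; allFin; cartesianProduct; cartesianProductWith)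
import Data.List.Extrema as Extrema
import Data.List.Membership.DecPropositional as DecMembership
open import Data.List.Membership.Propositional.Properties using (∈-allFin; ∈-filter⁺; ∈-cartesianProduct⁺; ∈-cartesianProductWith⁺)
open import Data.List.Properties using (length-map; length-upTo)
open import Data.List.Relation.Unary.All as All using ([]; _∷_)
import Data.List.Relation.Unary.All.Properties as All
open import Data.List.Relation.Unary.AllPairs as AllPairs using (AllPairs; []; _∷_)
import Data.List.Relation.Unary.AllPairs.Properties as AllPairs
open import Data.List.Relation.Unary.Any using (here; there)
import Data.List.Relation.Unary.Unique.Propositional.Properties as Unique
open import Data.Nat using (zero; suc; _+_; _<_; z≤n; s≤s; NonZero; >-nonZero)
open import Data.Nat.Divisibility using (divides-refl)
open import Data.Nat.ListAction using (sum)
open import Data.Nat.DivMod using (_/_; _%_; m≡m%n+[m/n]*n; m%n<n; [m+kn]%n≡m%n; m<n⇒m%n≡m; m<n⇒m/n≡0; m*n/n≡m; m/n*n≤m; m≥n⇒m/n>0; m<n*o⇒m/o<n; +-distrib-/-∣ʳ)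
import Data.Nat.Properties as ℕ
open import Data.Product using (_,_; proj₁; proj₂)
open import Data.Rational as ℚ using (0ℚ; 1ℚ)
import Data.Rational.Properties as ℚ
open import Data.Sum using (inj₁; inj₂)
open import Data.Vec as Vec using (Vec; []; _∷_; _++_; lookup; replicate; tabulate; toList; zipWith)
open import Data.Vec.Properties using (lookup∘tabulate; toList∘fromList)
open import Function using (id; _∘_; case_of_)
open import Relation.Binary using (DecTotalOrder; tri<; tri≈; tri>)
open import Relation.Binary.PropositionalEquality using (_≡_; _≢_; refl; sym; trans; cong; cong₂; subst; module ≡-Reasoning)
open import Relation.Nullary using (Dec; yes; no; does; ¬?; contradiction)
open Mult ℚ.+-0-monoid using (×-homo-+) renaming (_×_ to _·_)

-- Linear algebra over ℤ

dot : ∀ {N} → Vec ℤ N → Vec ℤ N → ℤ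
dot []      []      = 0ℤ
dot (x ∷ a) (y ∷ b) = x ℤ.* y ℤ.+ dot a b

-- Fraction-free elimination: cross-multiplying stays in ℤ, where a quotient of pivots need not
-- exist.
combine : ∀ {N} → ℤ → Vec ℤ N → ℤ → Vec ℤ N → Vec ℤ N
combine x a y b = zipWith (λ p q → x ℤ.* p ℤ.- y ℤ.* q) a b

dot-combine : ∀ {N} x (a : Vec ℤ N) y b c →
              dot (combine x a y b) c ≡ x ℤ.* dot a c ℤ.- y ℤ.* dot b c
dot-combine x []      y []      []      = vanish x y
  where
  vanish : ∀ x y → 0ℤ ≡ x ℤ.* 0ℤ ℤ.- y ℤ.* 0ℤ
  vanish = solve-∀
dot-combine x (p ∷ a) y (q ∷ b) (r ∷ c) =
  trans (cong (λ z → (x ℤ.* p ℤ.- y ℤ.* q) ℤ.* r ℤ.+ z) (dot-combine x a y b c))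
        (regroup x p y q r (dot a c) (dot b c))
  where
  regroup : ∀ x p y q r s t →
    (x ℤ.* p ℤ.- y ℤ.* q) ℤ.* r ℤ.+ (x ℤ.* s ℤ.- y ℤ.* t) ≡
    x ℤ.* (p ℤ.* r ℤ.+ s) ℤ.- y ℤ.* (q ℤ.* r ℤ.+ t)
  regroup = solve-∀

*-≢0 : ∀ {x y} → x ≢ 0ℤ → y ≢ 0ℤ → x ℤ.* y ≢ 0ℤ
*-≢0 {x} x≢0 y≢0 xy≡0 with ℤ.i*j≡0⇒i≡0∨j≡0 x xy≡0
... | inj₁ x≡0 = x≢0 x≡0
... | inj₂ y≡0 = y≢0 y≡0

-- The first component acts as a linear form, the second as a point.
Pairing : ℕ → Set
Pairing N = Vec ℤ N × Vec ℤ N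

Diagonal : ∀ {N} → Pairing N → Set
Diagonal (a , b) = dot a b ≢ 0ℤ

Annihilates : ∀ {N} → Vec ℤ N → Pairing N → Set
Annihilates a (_ , b) = dot a b ≡ 0ℤ

-- The matrix of the products of i-th form and j-th point is lower triangular with nonzero diagonal.
-- It factors through dimension `N`, which bounds its size.
Triangular : ∀ {N} → List (Pairing N) → Set
Triangular ps = All Diagonal ps × AllPairs (λ p → Annihilates (proj₁ p)) ps

eliminate : ∀ {N} → ℤ → Vec ℤ N → Pairing (suc N) → Pairing N
eliminate x a (x′ ∷ a′ , _ ∷ b′) = combine x a′ x′ a , b′

-- Once x ∷ a annihilates y ∷ b, eliminating with pivot x just scales the pairing with y ∷ b by x.
dot-eliminate : ∀ {N} x (a : Vec ℤ N) x′ a′ y b → dot (x ∷ a) (y ∷ b) ≡ 0ℤ →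
                dot (combine x a′ x′ a) b ≡ x ℤ.* dot (x′ ∷ a′) (y ∷ b)
dot-eliminate x a x′ a′ y b a⊥b = begin
  dot (combine x a′ x′ a) b
    ≡⟨ dot-combine x a′ x′ a b ⟩
  x ℤ.* dot a′ b ℤ.- x′ ℤ.* dot a b
    ≡⟨ regroup x x′ y (dot a′ b) (dot a b) ⟩
  x ℤ.* (x′ ℤ.* y ℤ.+ dot a′ b) ℤ.- x′ ℤ.* (x ℤ.* y ℤ.+ dot a b)
    ≡⟨ cong (λ z → x ℤ.* (x′ ℤ.* y ℤ.+ dot a′ b) ℤ.- x′ ℤ.* z) a⊥b ⟩
  x ℤ.* (x′ ℤ.* y ℤ.+ dot a′ b) ℤ.- x′ ℤ.* 0ℤ
    ≡⟨ drop (x ℤ.* (x′ ℤ.* y ℤ.+ dot a′ b)) x′ ⟩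
  x ℤ.* (x′ ℤ.* y ℤ.+ dot a′ b) ∎
  where
  open ≡-Reasoning
  regroup : ∀ x x′ y s t → x ℤ.* s ℤ.- x′ ℤ.* t ≡
    x ℤ.* (x′ ℤ.* y ℤ.+ s) ℤ.- x′ ℤ.* (x ℤ.* y ℤ.+ t)
  regroup = solve-∀
  drop : ∀ p q → p ℤ.- q ℤ.* 0ℤ ≡ p
  drop = solve-∀

dot-0∷ : ∀ {N} (a : Vec ℤ N) y b → dot (0ℤ ∷ a) (y ∷ b) ≡ dot a b
dot-0∷ a y b = ℤ.+-identityˡ (dot a b)

-- Every relevant product is multiplied by the nonzero `x`, so the pattern of zeros survives.
eliminate-triangular : ∀ {N} {x} {a : Vec ℤ N} → x ≢ 0ℤ → ∀ ps →
  All (Annihilates (x ∷ a)) ps → Triangular ps → Triangular (map (eliminate x a) ps)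
eliminate-triangular x≢0 [] _ _ = [] , []
eliminate-triangular {x = x} {a} x≢0 ((x′ ∷ a′ , y ∷ b) ∷ ps) (⊥p ∷ ⊥ps) (d ∷ ds , r ∷ rs)
  with ds′ , rs′ ← eliminate-triangular x≢0 ps ⊥ps (ds , rs) =
  (λ eq → *-≢0 x≢0 d (trans (sym (dot-eliminate x a x′ a′ y b ⊥p)) eq)) ∷ ds′ ,
  All.map⁺ (All.zipWith (λ {q} → kill q) (⊥ps , r)) ∷ rs′
  where
  kill : ∀ q → Annihilates (x ∷ a) q × Annihilates (x′ ∷ a′) q →
         Annihilates (combine x a′ x′ a) (eliminate x a q)
  kill (_ ∷ _ , y″ ∷ b″) (⊥q , eq) =
    trans (dot-eliminate x a x′ a′ y″ b″ ⊥q) (trans (cong (x ℤ.*_) eq) (ℤ.*-zeroʳ x))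

-- The pivot is the first entry of the list with nonzero leading coordinate: its vector annihilates
-- everything that follows it, and the entries before it need no elimination.
drop-coordinate : ∀ {N} (ps : List (Pairing (suc N))) → Triangular ps →
  ∃[ qs ] (length ps ≤ suc (length qs) × Triangular qs ×
           (∀ a → All (Annihilates (0ℤ ∷ a)) ps → All (Annihilates {N} a) qs))
drop-coordinate [] _ = [] , z≤n , ([] , []) , λ _ _ → []
drop-coordinate ((x ∷ a , y ∷ b) ∷ ps) (d ∷ ds , r ∷ rs) with x ℤ.≟ 0ℤ
... | no x≢0 =
  map (eliminate x a) ps , s≤s (ℕ.≤-reflexive (sym (length-map _ ps))) ,
  eliminate-triangular x≢0 ps r (ds , rs) ,
  λ { c (_ ∷ ⊥ps) → All.map⁺ (All.map (λ { {_ ∷ _ , y′ ∷ b′} eq → trans (sym (dot-0∷ c y′ b′)) eq }) ⊥ps) }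
... | yes refl with qs , len , (ds′ , rs′) , ann ← drop-coordinate ps (ds , rs) =
  (a , b) ∷ qs , s≤s len ,
  -- The head form has leading coordinate 0; `ann` ensures that it still annihilates the points the
  -- recursion returns.
  ((d ∘ trans (dot-0∷ a y b)) ∷ ds′ , ann a r ∷ rs′) ,
  λ { c (⊥p ∷ ⊥ps) → trans (sym (dot-0∷ c y b)) ⊥p ∷ ann c ⊥ps }

-- Induction on the dimension: losing a coordinate costs at most one entry, and in dimension 0 every
-- product is 0.
triangular⇒length≤ : ∀ {N} (ps : List (Pairing N)) → Triangular ps → length ps ≤ N
triangular⇒length≤ {zero} [] _ = z≤n
triangular⇒length≤ {zero} (([] , []) ∷ _) (d ∷ _ , _) = contradiction refl d
triangular⇒length≤ {suc N} ps tri with qs , len , tri′ , _ ← drop-coordinate ps tri =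
  ℕ.≤-trans len (s≤s (triangular⇒length≤ qs tri′))

-- Tensor products of integer vectors

infixr 6 _⊗_

_⊗_ : ∀ {M N} → Vec ℤ M → Vec ℤ N → Vec ℤ (M * N)
[]      ⊗ b = []
(x ∷ a) ⊗ b = Vec.map (x ℤ.*_) b ++ a ⊗ b

dot-++ : ∀ {M N} (a a′ : Vec ℤ M) (b b′ : Vec ℤ N) →
         dot (a ++ b) (a′ ++ b′) ≡ dot a a′ ℤ.+ dot b b′
dot-++ []      []        b b′ = sym (ℤ.+-identityˡ (dot b b′))
dot-++ (x ∷ a) (y ∷ a′) b b′ =
  trans (cong (λ z → x ℤ.* y ℤ.+ z) (dot-++ a a′ b b′))
        (sym (ℤ.+-assoc (x ℤ.* y) (dot a a′) (dot b b′)))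

dot-scale : ∀ {N} x y (a b : Vec ℤ N) →
            dot (Vec.map (x ℤ.*_) a) (Vec.map (y ℤ.*_) b) ≡ x ℤ.* y ℤ.* dot a b
dot-scale x y []      []      = sym (ℤ.*-zeroʳ (x ℤ.* y))
dot-scale x y (p ∷ a) (q ∷ b) =
  trans (cong (λ z → x ℤ.* p ℤ.* (y ℤ.* q) ℤ.+ z) (dot-scale x y a b)) (regroup x y p q (dot a b))
  where
  regroup : ∀ x y p q s →
    x ℤ.* p ℤ.* (y ℤ.* q) ℤ.+ x ℤ.* y ℤ.* s ≡ x ℤ.* y ℤ.* (p ℤ.* q ℤ.+ s)
  regroup = solve-∀

-- Lets a product of linear forms be evaluated as one linear form on the vector of monomials.
dot-⊗ : ∀ {M N} (a a′ : Vec ℤ M) (b b′ : Vec ℤ N) →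
        dot (a ⊗ b) (a′ ⊗ b′) ≡ dot a a′ ℤ.* dot b b′
dot-⊗ []      []       b b′ = refl
dot-⊗ (x ∷ a) (y ∷ a′) b b′ = begin
  dot (Vec.map (x ℤ.*_) b ++ a ⊗ b) (Vec.map (y ℤ.*_) b′ ++ a′ ⊗ b′)
    ≡⟨ dot-++ (Vec.map (x ℤ.*_) b) (Vec.map (y ℤ.*_) b′) (a ⊗ b) (a′ ⊗ b′) ⟩
  dot (Vec.map (x ℤ.*_) b) (Vec.map (y ℤ.*_) b′) ℤ.+ dot (a ⊗ b) (a′ ⊗ b′)
    ≡⟨ cong₂ ℤ._+_ (dot-scale x y b b′) (dot-⊗ a a′ b b′) ⟩
  x ℤ.* y ℤ.* dot b b′ ℤ.+ dot a a′ ℤ.* dot b b′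
    ≡⟨ ℤ.*-distribʳ-+ (dot b b′) (x ℤ.* y) (dot a a′) ⟨
  (x ℤ.* y ℤ.+ dot a a′) ℤ.* dot b b′ ∎
  where open ≡-Reasoning

unit : ∀ {N} → Fin N → Vec ℤ N
unit zero    = 1ℤ ∷ replicate _ 0ℤ
unit (suc i) = 0ℤ ∷ unit i

dot-unit : ∀ {N} (i : Fin N) b → dot (unit i) b ≡ lookup b i
dot-unit zero (y ∷ b) =
  trans (cong₂ ℤ._+_ (ℤ.*-identityˡ y) (dot-0 b)) (ℤ.+-identityʳ y)
  where
  dot-0 : ∀ {N} (b : Vec ℤ N) → dot (replicate N 0ℤ) b ≡ 0ℤ
  dot-0 []      = refl
  dot-0 (y ∷ b) = trans (dot-0∷ (replicate _ 0ℤ) y b) (dot-0 b)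
dot-unit (suc i) (y ∷ b) = trans (dot-0∷ (unit i) y b) (dot-unit i b)

-- The polynomial of a demand graph

Demands : ℕ → ℕ → Set
Demands n k = Vec (Fin n × Fin n) k

edgeVec : ∀ {n} → Fin n × Fin n → Vec ℤ n
edgeVec (u , v) = combine 1ℤ (unit u) 1ℤ (unit v)

-- Coefficients of ∏ (x_u − x_v) over the demand pairs, indexed by noncommutative monomials.
demandVec : ∀ {n k} → Demands n k → Vec ℤ (n ^ k)
demandVec []      = 1ℤ ∷ []
demandVec (p ∷ D) = edgeVec p ⊗ demandVec D

labels : ∀ {n} → Partition n → Vec ℤ n
labels Π = tabulate (λ u → + toℕ (Π u))

-- Values of the noncommutative monomials of degree `k` at the labels, ordered as in `demandVec`, so
-- that `dot` evaluates the polynomial.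
monomials : ∀ {n} → Partition n → ∀ k → Vec ℤ (n ^ k)
monomials Π zero    = 1ℤ ∷ []
monomials Π (suc k) = labels Π ⊗ monomials Π k

dot-edgeVec : ∀ {n} (Π : Partition n) u v →
              dot (edgeVec (u , v)) (labels Π) ≡ + toℕ (Π u) ℤ.- + toℕ (Π v)
dot-edgeVec Π u v = begin
  dot (edgeVec (u , v)) (labels Π)
    ≡⟨ dot-combine 1ℤ (unit u) 1ℤ (unit v) (labels Π) ⟩
  1ℤ ℤ.* dot (unit u) (labels Π) ℤ.- 1ℤ ℤ.* dot (unit v) (labels Π)
    ≡⟨ cong₂ ℤ._-_ (coordinate u) (coordinate v) ⟩
  + toℕ (Π u) ℤ.- + toℕ (Π v) ∎
  where
  open ≡-Reasoning
  coordinate : ∀ i → 1ℤ ℤ.* dot (unit i) (labels Π) ≡ + toℕ (Π i)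
  coordinate i = trans (ℤ.*-identityˡ _)
    (trans (dot-unit i (labels Π)) (lookup∘tabulate (λ u → + toℕ (Π u)) i))

-- Each factor is a difference of distinct labels, and ℤ has no zero divisors.
agrees⇒≢0 : ∀ {n k} (Π : Partition n) (D : Demands n k) → Agrees Π (toList D) →
            dot (demandVec D) (monomials Π k) ≢ 0ℤ
agrees⇒≢0 Π [] _ ()
agrees⇒≢0 {k = suc k} Π ((u , v) ∷ D) (Πu≢Πv ∷ agrees) eq =
  *-≢0 edge≢0 (agrees⇒≢0 Π D agrees)
    (trans (sym (dot-⊗ (edgeVec (u , v)) (labels Π) (demandVec D) (monomials Π k))) eq)
  where
  edge≢0 : dot (edgeVec (u , v)) (labels Π) ≢ 0ℤ
  edge≢0 eq = Πu≢Πv (toℕ-injective (ℤ.+-injective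
    (ℤ.i-j≡0⇒i≡j (+ toℕ (Π u)) (+ toℕ (Π v)) (trans (sym (dot-edgeVec Π u v)) eq))))

-- A demand pair with equal labels contributes a factor 0, which would kill the whole product.
≢0⇒agrees : ∀ {n k} (Π : Partition n) (D : Demands n k) →
            dot (demandVec D) (monomials Π k) ≢ 0ℤ → Agrees Π (toList D)
≢0⇒agrees Π [] _ = []
≢0⇒agrees {k = suc k} Π ((u , v) ∷ D) ≢0 =
  (λ Πu≡Πv → ≢0 (trans product (trans (cong (ℤ._* rest)
    (trans (dot-edgeVec Π u v) (ℤ.i≡j⇒i-j≡0 (cong (+_ ∘ toℕ) Πu≡Πv)))) (ℤ.*-zeroˡ rest)))) ∷
  ≢0⇒agrees Π D (λ eq → ≢0 (trans product
    (trans (cong (dot (edgeVec (u , v)) (labels Π) ℤ.*_) eq) (ℤ.*-zeroʳ (dot (edgeVec (u , v)) (labels Π))))))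
  where
  rest = dot (demandVec D) (monomials Π k)
  product = dot-⊗ (edgeVec (u , v)) (labels Π) (demandVec D) (monomials Π k)

-- Optimal partitions

vectors : ∀ {A : Set} → List A → ∀ k → List (Vec A k)
vectors xs zero    = [] ∷ []
vectors xs (suc k) = cartesianProductWith _∷_ xs (vectors xs k)

∈-vectors : ∀ {A : Set} {xs : List A} → (∀ x → x ∈ xs) → ∀ {k} (v : Vec A k) → v ∈ vectors xs k
∈-vectors complete []      = here refl
∈-vectors complete (x ∷ v) = ∈-cartesianProductWith⁺ _∷_ (complete x) (∈-vectors complete v)

sumFin-cong : ∀ {n} {f g : Fin n → ℚ} → (∀ i → f i ≡ g i) → sumFin f ≡ sumFin g
sumFin-cong {zero}  f≡g = refl
sumFin-cong {suc n} f≡g = cong₂ ℚ._+_ (f≡g zero) (sumFin-cong (f≡g ∘ suc))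

-- A labelling and its tabulation are only known to agree pointwise, so cuts are compared along
-- pointwise equality.
cut-cong : ∀ {n} (w : Weights n) {Π Π′ : Partition n} → (∀ u → Π u ≡ Π′ u) → cut w Π ≡ cut w Π′
cut-cong w Π≡Π′ = sumFin-cong λ u → sumFin-cong λ v →
  cong₂ (λ p q → if does (toℕ u ℕ.<? toℕ v) ∧ not (does (p ≟F q)) then w u v else 0ℚ) (Π≡Π′ u) (Π≡Π′ v)

-- Lists with strictly decreasing values

module _ {A : Set} (f : A → ℚ) where

  Descending : List A → Set
  Descending = AllPairs (λ x y → f y ℚ.< f x)

  -- On a tie `x` is discarded, hence the claim about values instead of elements. The clause over
  -- `P` serves the recursion: it carries the bound by the head over to the new tail.
  insert : ∀ x xs → Descending xs →
    ∃[ ys ] (Descending ys × (∀ (P : ℚ → Set) → P (f x) → All (P ∘ f) xs → All (P ∘ f) ys) ×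
             (∀ {c} → c ∈ map f (x ∷ xs) → c ∈ map f ys))
  insert x [] [] = x ∷ [] , [] ∷ [] , (λ _ p _ → p ∷ []) , id
  insert x (y ∷ xs) (r ∷ rs) with ℚ.<-cmp (f x) (f y)
  ... | tri> _ _ y<x =
    x ∷ y ∷ xs , (y<x ∷ All.map (λ z<y → ℚ.<-trans z<y y<x) r) ∷ r ∷ rs , (λ _ → _∷_) , id
  ... | tri≈ _ x≡y _ =
    y ∷ xs , r ∷ rs , (λ _ _ → id) , λ { (here refl) → here x≡y ; (there c∈) → c∈ }
  ... | tri< x<y _ _ with ys , desc , all , covers ← insert x xs rs =
    y ∷ ys , all (ℚ._< f y) x<y r ∷ desc , (λ { P p (q ∷ qs) → q ∷ all P p qs }) ,
    λ { (here eq) → there (covers (here eq))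
      ; (there (here eq)) → here eq
      ; (there (there c∈)) → there (covers (there c∈)) }

Loopless : ∀ {n} → DemandGraph n → Set
Loopless D = All (λ p → proj₁ p ≢ proj₂ p) D

module _ {n : ℕ} (w : Weights n) where

  -- The number of demands is in the type, so that all polynomials for one `k` live in the same
  -- space.
  record Solution (k : ℕ) : Set where
    constructor solution
    field
      demands : Demands n k
      optimum : Partition n
      agrees  : Agrees optimum (toList demands)
      minimal : ∀ Π → Agrees Π (toList demands) → cut w optimum ℚ.≤ cut w Π

    value : ℚ
    value = cut w optimum

  open Solution

  solve : ∀ {k} (D : Demands n k) → Loopless (toList D) → ∃[ s ] demands {k} s ≡ D
  solve {k} D loopless = solution D (lookup best) best-agrees best-minimal , refl
    where
    open Extrema (DecTotalOrder.totalOrder ℚ.≤-decTotalOrder) using (argmin; argmin-all; f[argmin]≤f[xs])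

    Feasible : Vec (Fin n) n → Set
    Feasible Π = Agrees (lookup Π) (toList D)

    feasible? : ∀ Π → _
    feasible? Π = All.all? (λ p → ¬? (lookup Π (proj₁ p) ≟F lookup Π (proj₂ p))) (toList D)

    relabel : ∀ {Π Π′ : Partition n} → (∀ u → Π u ≡ Π′ u) → Agrees Π (toList D) → Agrees Π′ (toList D)
    relabel Π≡Π′ = All.map λ { {u , v} Πu≢Πv eq → Πu≢Πv (trans (Π≡Π′ u) (trans eq (sym (Π≡Π′ v)))) }

    candidates = filter feasible? (vectors (allFin n) n)

    -- The default value is the identity labelling, which separates all vertices; looplessness makes
    -- it feasible.
    best = argmin (cut w ∘ lookup) (tabulate id) candidates

    best-agrees : Feasible best
    best-agrees = argmin-all (cut w ∘ lookup)
      (relabel (sym ∘ lookup∘tabulate id) loopless)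
      (All.all-filter feasible? (vectors (allFin n) n))

    best-minimal : ∀ Π → Agrees Π (toList D) → cut w (lookup best) ℚ.≤ cut w Π
    best-minimal Π agrees =
      subst (cut w (lookup best) ℚ.≤_) (cut-cong w (lookup∘tabulate Π))
        (All.lookup (f[argmin]≤f[xs] {f = cut w ∘ lookup} (tabulate id) candidates)
          (∈-filter⁺ feasible? (∈-vectors ∈-allFin (tabulate Π))
            (relabel (sym ∘ lookup∘tabulate Π) agrees)))

  value-unique : ∀ {k} (s : Solution k) {c} → IsMincut w (toList (demands s)) c → c ≡ value s
  value-unique s ((Π , Π-agrees , refl) , lower) =
    ℚ.≤-antisym (lower (optimum s) (agrees s)) (minimal s Π Π-agrees)

  -- One solution survives per distinct value, since `insert` discards ties.
  solveAll : ∀ {k} (Ds : List (Demands n k)) →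
    ∃[ ss ] (Descending (value {k}) ss ×
             (∀ {D c} → D ∈ Ds → Loopless (toList D) → IsMincut w (toList D) c → c ∈ map value ss))
  solveAll [] = [] , [] , λ ()
  solveAll (D ∷ Ds) with ss , desc , covers ← solveAll Ds
                       | All.all? (λ p → ¬? (proj₁ p ≟F proj₂ p)) (toList D)
  ... | no loop = ss , desc , λ { (here refl) loopless _ → contradiction loopless loop ; (there D∈) → covers D∈ }
  ... | yes loopless with s , refl ← solve D loopless with ts , desc′ , _ , covers′ ← insert value s ss desc =
    ts , desc′ , λ { (here refl) _ mincut → covers′ (here (value-unique s mincut))
                   ; (there D∈) loopless mincut → covers′ (there (covers D∈ loopless mincut)) }

  -- The upper bound

  pairing : ∀ {k} → Solution k → Pairing (n ^ k)
  pairing {k} s = demandVec (demands s) , monomials (optimum s) k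

  -- An optimum cheaper than s cannot agree with the demands of s, so their polynomial vanishes on it.
  descending⇒length≤ : ∀ {k} (ss : List (Solution k)) → Descending value ss → length ss ≤ n ^ k
  descending⇒length≤ {k} ss desc = subst (_≤ n ^ k) (length-map pairing ss)
    (triangular⇒length≤ (map pairing ss)
      (All.map⁺ (All.universal (λ s → agrees⇒≢0 (optimum s) (demands s) (agrees s)) ss) ,
       AllPairs.map⁺ (AllPairs.map (λ {s} {t} → vanish s t) desc)))
    where
    vanish : ∀ s t → value t ℚ.< value s → Annihilates (proj₁ (pairing s)) (pairing t)
    vanish s t t<s with dot (demandVec (demands s)) (monomials (optimum t) k) ℤ.≟ 0ℤ
    ... | yes eq = eq
    ... | no ≢0 = contradiction
      (ℚ.<-≤-trans t<s (minimal s (optimum t) (≢0⇒agrees (optimum t) (demands s) ≢0)))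
      (ℚ.<-irrefl refl)

  mincut-values≤ : ∀ k → ∃[ L ] (length L ≤ n ^ k × (∀ c → IsKMincutValue w k c → c ∈ L))
  mincut-values≤ k
    -- The search runs over all (n²)^k lists of `k` pairs; triangularity leaves at most n^k values.
    with ss , desc , covers ← solveAll (vectors (cartesianProduct (allFin n) (allFin n)) k) =
    map value ss , subst (_≤ n ^ k) (sym (length-map value ss)) (descending⇒length≤ ss desc) , complete
    where
    complete : ∀ c → IsKMincutValue w k c → c ∈ map value ss
    complete c (D , (_ , loopless) , refl , mincut) =
      covers (∈-vectors (λ { (u , v) → ∈-cartesianProduct⁺ (∈-allFin u) (∈-allFin v) }) (Vec.fromList D))
        (subst Loopless (sym (toList∘fromList D)) loopless)
        (subst (λ D → IsMincut w D c) (sym (toList∘fromList D)) mincut)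

-- The star with weights in base m

sumFin-zero : ∀ n → sumFin {n} (λ _ → 0ℚ) ≡ 0ℚ
sumFin-zero zero    = refl
sumFin-zero (suc n) = trans (ℚ.+-identityˡ _) (sumFin-zero n)

sumFin-mono : ∀ {n} {f g : Fin n → ℚ} → (∀ i → f i ℚ.≤ g i) → sumFin f ℚ.≤ sumFin g
sumFin-mono {zero}  f≤g = ℚ.≤-refl
sumFin-mono {suc n} f≤g = ℚ.+-mono-≤ (f≤g zero) (sumFin-mono (f≤g ∘ suc))

sumFin-+ : ∀ {n} (f g : Fin n → ℚ) → sumFin (λ i → f i ℚ.+ g i) ≡ sumFin f ℚ.+ sumFin g
sumFin-+ {zero}  f g = refl
sumFin-+ {suc n} f g =
  trans (cong (f zero ℚ.+ g zero ℚ.+_) (sumFin-+ (f ∘ suc) (g ∘ suc)))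
        (interchange (f zero) (g zero) (sumFin (f ∘ suc)) (sumFin (g ∘ suc)))
  where open CommutativeSemigroupProperties (CommutativeMonoid.commutativeSemigroup ℚ.+-0-commutativeMonoid) using (interchange)

sumFin-single : ∀ {n} (a : Fin n → ℚ) x → sumFin (λ i → if does (i ≟F x) then a i else 0ℚ) ≡ a x
sumFin-single {suc n} a zero    = trans (cong (a zero ℚ.+_) (sumFin-zero n)) (ℚ.+-identityʳ (a zero))
sumFin-single {suc n} a (suc x) = trans (ℚ.+-identityˡ _) (sumFin-single (a ∘ suc) x)

sumℚ : List ℚ → ℚ
sumℚ = foldr ℚ._+_ 0ℚ

infix 4 _∈F?_

_∈F?_ : ∀ {n} (i : Fin n) S → Dec (i ∈ S)
_∈F?_ = DecMembership._∈?_ _≟F_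

restrict : ∀ {n} → (Fin n → ℚ) → List (Fin n) → Fin n → ℚ
restrict a S i = if does (i ∈F? S) then a i else 0ℚ

-- Links the sum over all leaves, as in `cut`, with the sum over chosen leaves, as in a digit
-- expansion. As `x` does not recur in `S`, its summand splits off cleanly.
sumFin-restrict : ∀ {n} (a : Fin n → ℚ) {S} → Unique S → sumFin (restrict a S) ≡ sumℚ (map a S)
sumFin-restrict {n} a [] = sumFin-zero n
sumFin-restrict a {x ∷ S} (x∉S ∷ unique) = begin
  sumFin (restrict a (x ∷ S))
    ≡⟨ sumFin-cong split ⟩
  sumFin (λ i → (if does (i ≟F x) then a i else 0ℚ) ℚ.+ restrict a S i)
    ≡⟨ sumFin-+ (λ i → if does (i ≟F x) then a i else 0ℚ) (restrict a S) ⟩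
  sumFin (λ i → if does (i ≟F x) then a i else 0ℚ) ℚ.+ sumFin (restrict a S)
    ≡⟨ cong₂ ℚ._+_ (sumFin-single a x) (sumFin-restrict a unique) ⟩
  a x ℚ.+ sumℚ (map a S) ∎
  where
  open ≡-Reasoning
  split : ∀ i → restrict a (x ∷ S) i ≡ (if does (i ≟F x) then a i else 0ℚ) ℚ.+ restrict a S i
  split i with i ≟F x | i ∈F? S
  ... | yes refl | yes i∈S = contradiction refl (All.lookup x∉S i∈S)
  ... | yes _    | no _    = sym (ℚ.+-identityʳ (a i))
  ... | no _     | yes _   = sym (ℚ.+-identityˡ (a i))
  ... | no _     | no _    = refl

-- The centre is the least vertex, so the spokes lie in the half of the table that `cut` reads.
star : ∀ {n} → (Fin n → ℚ) → Weights (suc n)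
star a zero    zero    = 0ℚ
star a zero    (suc i) = a i
star a (suc _) _       = 0ℚ

star-nonNeg : ∀ {n} {a : Fin n → ℚ} → (∀ i → 0ℚ ℚ.≤ a i) → NonNeg (star a)
star-nonNeg a≥0 zero    zero    = ℚ.≤-refl
star-nonNeg a≥0 zero    (suc i) = a≥0 i
star-nonNeg a≥0 (suc _) _       = ℚ.≤-refl

separatedWeight : ∀ {n} → (Fin n → ℚ) → Partition (suc n) → Fin n → ℚ
separatedWeight a Π i = if not (does (Π zero ≟F Π (suc i))) then a i else 0ℚ

cut-star : ∀ {n} (a : Fin n → ℚ) Π → cut (star a) Π ≡ sumFin (separatedWeight a Π)
cut-star {n} a Π = begin
  -- The leading `0ℚ` is the pair of the centre with itself; the second sum collects the rows of the
  -- leaves, all of weight 0.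
  (0ℚ ℚ.+ sumFin (separatedWeight a Π)) ℚ.+ sumFin {n} (λ u → sumFin (leafEdge u))
    ≡⟨ cong₂ ℚ._+_ (ℚ.+-identityˡ (sumFin (separatedWeight a Π))) (trans (sumFin-cong leaf-leaf) (sumFin-zero n)) ⟩
  sumFin (separatedWeight a Π) ℚ.+ 0ℚ
    ≡⟨ ℚ.+-identityʳ (sumFin (separatedWeight a Π)) ⟩
  sumFin (separatedWeight a Π) ∎
  where
  open ≡-Reasoning
  leafEdge : Fin n → Fin (suc n) → ℚ
  leafEdge u v = if does (toℕ (suc u) ℕ.<? toℕ v) ∧ not (does (Π (suc u) ≟F Π v)) then 0ℚ else 0ℚ
  leaf-leaf : ∀ u → sumFin (leafEdge u) ≡ 0ℚ
  leaf-leaf u = trans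
    (sumFin-cong {g = λ _ → 0ℚ} (λ v → if-eta (does (toℕ (suc u) ℕ.<? toℕ v) ∧ not (does (Π (suc u) ≟F Π v)))))
    (sumFin-zero (suc n))

isolate : ∀ {n} → List (Fin n) → Partition (suc n)
isolate S zero    = zero
isolate S (suc i) = if does (i ∈F? S) then suc i else zero

spokes : ∀ {n} → List (Fin n) → DemandGraph (suc n)
spokes = map (λ i → zero , suc i)

spokes-valid : ∀ {n} {S : List (Fin n)} → Unique S → ValidDemand (spokes S)
spokes-valid {S = S} unique =
  Unique.map⁺ (λ { refl → refl }) unique , All.map⁺ (All.universal (λ _ ()) S)

-- `isolate S` cuts the spokes to `S` and no others. An agreeing partition cuts at least these, and
-- any further spokes have nonnegative weight.
star-mincut : ∀ {n} {a : Fin n → ℚ} → (∀ i → 0ℚ ℚ.≤ a i) → ∀ {S} → Unique S →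
              IsMincut (star a) (spokes S) (sumℚ (map a S))
star-mincut {a = a} a≥0 {S} unique =
  (isolate S , All.map⁺ (All.tabulate isolated) , isolate-value) , minimal
  where
  isolated : ∀ {i} → i ∈ S → zero ≢ isolate S (suc i)
  isolated {i} i∈S with i ∈F? S
  ... | yes _  = λ ()
  ... | no i∉S = contradiction i∈S i∉S

  separated : ∀ i → separatedWeight a (isolate S) i ≡ restrict a S i
  separated i with i ∈F? S
  ... | yes _ = refl
  ... | no _  = refl

  isolate-value : cut (star a) (isolate S) ≡ sumℚ (map a S)
  isolate-value = trans (cut-star a (isolate S)) (trans (sumFin-cong separated) (sumFin-restrict a unique))

  restrict≤ : ∀ Π → Agrees Π (spokes S) → ∀ i → restrict a S i ℚ.≤ separatedWeight a Π i
  restrict≤ Π agrees i with i ∈F? S | Π zero ≟F Π (suc i)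
  ... | yes i∈S | yes eq = contradiction eq (All.lookup (All.map⁻ agrees) i∈S)
  ... | yes _   | no _   = ℚ.≤-refl
  ... | no _    | yes _  = ℚ.≤-refl
  ... | no _    | no _   = a≥0 i

  minimal : ∀ Π → Agrees Π (spokes S) → sumℚ (map a S) ℚ.≤ cut (star a) Π
  minimal Π agrees = begin
    sumℚ (map a S)               ≡⟨ sumFin-restrict a unique ⟨
    sumFin (restrict a S)        ≤⟨ sumFin-mono (restrict≤ Π agrees) ⟩
    sumFin (separatedWeight a Π) ≡⟨ cut-star a Π ⟨
    cut (star a) Π               ∎
    where open ℚ.≤-Reasoning

-- Natural numbers as rational weights

fromℕ : ℕ → ℚ
fromℕ n = n · 1ℚ

fromℕ-nonNeg : ∀ n → 0ℚ ℚ.≤ fromℕ n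
fromℕ-nonNeg zero    = ℚ.≤-refl
fromℕ-nonNeg (suc n) = ℚ.+-mono-≤ (ℚ.nonNegative⁻¹ 1ℚ) (fromℕ-nonNeg n)

fromℕ-mono-< : ∀ {m n} → m < n → fromℕ m ℚ.< fromℕ n
fromℕ-mono-< {zero}  {suc n} _         = ℚ.+-mono-<-≤ (ℚ.positive⁻¹ 1ℚ) (fromℕ-nonNeg n)
fromℕ-mono-< {suc m} {suc n} (s≤s m<n) = ℚ.+-monoʳ-< 1ℚ (fromℕ-mono-< m<n)

fromℕ-injective : ∀ {m n} → fromℕ m ≡ fromℕ n → m ≡ n
fromℕ-injective {m} {n} eq with ℕ.<-cmp m n
... | tri< m<n _ _ = contradiction eq (ℚ.<⇒≢ (fromℕ-mono-< m<n))
... | tri≈ _ m≡n _ = m≡n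
... | tri> _ _ n<m = contradiction (sym eq) (ℚ.<⇒≢ (fromℕ-mono-< n<m))

sumℚ-fromℕ : ∀ {A : Set} (f : A → ℕ) xs → sumℚ (map (fromℕ ∘ f) xs) ≡ fromℕ (sum (map f xs))
sumℚ-fromℕ f []       = refl
sumℚ-fromℕ f (x ∷ xs) =
  trans (cong (fromℕ (f x) ℚ.+_) (sumℚ-fromℕ f xs)) (sym (×-homo-+ 1ℚ (f x) (sum (map f xs))))

-- Base-m digits as leaves

module _ (m : ℕ) .{{_ : NonZero m}} where

  -- Leaf q + j m stands for the digit q in position j.
  leafWeight : ℕ → ℕ
  leafWeight i = i % m * m ^ (i / m)

  leafWeight-digit : ∀ j {q} → q < m → leafWeight (q + j * m) ≡ q * m ^ j
  leafWeight-digit j {q} q<m = cong₂ (λ d e → d * m ^ e)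
    (trans ([m+kn]%n≡m%n q j m) (m<n⇒m%n≡m q<m))
    (trans (+-distrib-/-∣ʳ q (divides-refl j)) (cong₂ _+_ (m<n⇒m/n≡0 q<m) (m*n/n≡m j m)))

  -- The bound `k * m` confines the leaves to the first `k` positions, so a leaf for position `k` is
  -- new. A digit 0 also gets a leaf, of weight 0, which keeps the number of demands at exactly `k`.
  HasDigits : ℕ → ℕ → ℕ → Set
  HasDigits n k c = ∃[ S ] (length S ≡ k × Unique S × All (λ i → toℕ i < k * m) S ×
                            sum (map (leafWeight ∘ toℕ {n}) S) ≡ c)

  prepend-digit : ∀ {n k q r} → q < m → suc k * m ≤ n → HasDigits n k r → HasDigits n (suc k) (r + q * m ^ k)
  prepend-digit {n} {k} {q} {r} q<m km≤n (S , len , unique , bounded , total) =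
    leaf ∷ S , cong suc len , All.map fresh bounded ∷ unique ,
    subst (_< suc k * m) (sym leaf≡) t<km ∷ All.map (λ i<km → ℕ.<-≤-trans i<km (ℕ.m≤n+m (k * m) m)) bounded ,
    trans (cong₂ _+_ (trans (cong leafWeight leaf≡) (leafWeight-digit k q<m)) total) (ℕ.+-comm (q * m ^ k) r)
    where
    t<km : q + k * m < suc k * m
    t<km = ℕ.+-monoˡ-< (k * m) q<m
    leaf : Fin n
    leaf = fromℕ< (ℕ.<-≤-trans t<km km≤n)
    leaf≡ : toℕ leaf ≡ q + k * m
    leaf≡ = toℕ-fromℕ< (ℕ.<-≤-trans t<km km≤n)
    fresh : ∀ {i} → toℕ i < k * m → leaf ≢ i
    fresh i<km refl = ℕ.<⇒≱ i<km (subst (k * m ≤_) (sym leaf≡) (ℕ.m≤n+m (k * m) q))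

  -- Splits off the top digit, the quotient by `m ^ k`, and recurses on the remainder.
  digits : ∀ {n} k → k * m ≤ n → ∀ c → c < m ^ k → HasDigits n k c
  digits zero    _    zero    _        = [] , refl , [] , [] , refl
  digits zero    _    (suc c) (s≤s ())
  digits (suc k) km≤n c c<m^k = subst (HasDigits _ (suc k)) (sym (m≡m%n+[m/n]*n c (m ^ k)))
    (prepend-digit (m<n*o⇒m/o<n c<m^k) km≤n
      (digits k (ℕ.≤-trans (ℕ.m≤n+m (k * m) m) km≤n) (c % m ^ k) (m%n<n c (m ^ k))))
    where instance _ = ℕ.m^n≢0 m k

  digitStar : ∀ n → Weights (suc n)
  digitStar n = star (fromℕ ∘ leafWeight ∘ toℕ {n})

  digitStar-nonNeg : ∀ n → NonNeg (digitStar n)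
  digitStar-nonNeg n = star-nonNeg (λ i → fromℕ-nonNeg (leafWeight (toℕ i)))

  digitStar-value : ∀ {n} k → k * m ≤ n → ∀ {c} → c < m ^ k → IsKMincutValue (digitStar n) k (fromℕ c)
  digitStar-value k km≤n {c} c<m^k with S , len , unique , _ , total ← digits k km≤n c c<m^k =
    spokes S , spokes-valid unique , trans (length-map _ S) len ,
    subst (IsMincut (digitStar _) (spokes S)) (trans (sumℚ-fromℕ (leafWeight ∘ toℕ) S) (cong fromℕ total))
      (star-mincut (λ i → fromℕ-nonNeg (leafWeight (toℕ i))) unique)

^-distribʳ-* : ∀ a b k → (a * b) ^ k ≡ a ^ k * b ^ k
^-distribʳ-* a b zero    = refl
^-distribʳ-* a b (suc k) =
  trans (cong (a * b *_) (^-distribʳ-* a b k)) (ℕ.[m*n]*[o*p]≡[m*o]*[n*p] a b (a ^ k) (b ^ k))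

many-mincut-values : ∀ k n → k + 2 ≤ n →
  Σ[ w ∈ Weights n ] (NonNeg w ×
    ∃[ L ] (Unique L × All (IsKMincutValue w k) L × n ^ k ≤ (2 * suc k) ^ k * length L))
many-mincut-values k zero k+2≤0 = contradiction (ℕ.≤-trans (ℕ.m≤n+m 2 k) k+2≤0) λ ()
many-mincut-values k (suc n) k+2≤n =
  digitStar m n , digitStar-nonNeg m n , map fromℕ (upTo (m ^ k)) ,
  Unique.map⁺ fromℕ-injective (Unique.upTo⁺ (m ^ k)) ,
  All.map⁺ (All.map (digitStar-value m k km≤n) (All.all-upTo (m ^ k))) ,
  enough
  where
  1+k≤n : suc k ≤ n
  1+k≤n = ℕ.≤-pred (subst (_≤ suc n) (ℕ.+-comm k 2) k+2≤n)

  -- The divisor `suc k` is positive even for `k = 0`, and `k * m` leaves still fit.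
  m = n / suc k

  m>0 : 0 < m
  m>0 = m≥n⇒m/n>0 1+k≤n

  instance _ = >-nonZero m>0

  km≤n : k * m ≤ n
  km≤n = begin
    k * m     ≤⟨ ℕ.m≤n+m (k * m) m ⟩
    suc k * m ≡⟨ ℕ.*-comm (suc k) m ⟩
    m * suc k ≤⟨ m/n*n≤m n (suc k) ⟩
    n         ∎
    where open ℕ.≤-Reasoning

  -- The remainder together with the centre is at most `suc k`, hence at most `m * suc k` as `m` is
  -- positive; this is the factor 2.
  1+n≤ : suc n ≤ 2 * suc k * m
  1+n≤ = begin
    suc n                         ≡⟨ cong suc (m≡m%n+[m/n]*n n (suc k)) ⟩
    suc (n % suc k) + m * suc k   ≤⟨ ℕ.+-monoˡ-≤ (m * suc k) (m%n<n n (suc k)) ⟩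
    suc k + m * suc k             ≤⟨ ℕ.+-monoˡ-≤ (m * suc k) (ℕ.m≤n*m (suc k) m) ⟩
    m * suc k + m * suc k         ≡⟨ cong₂ _+_ refl (ℕ.+-identityʳ (m * suc k)) ⟨
    2 * (m * suc k)               ≡⟨ cong (2 *_) (ℕ.*-comm m (suc k)) ⟩
    2 * (suc k * m)               ≡⟨ ℕ.*-assoc 2 (suc k) m ⟨
    2 * suc k * m                 ∎
    where open ℕ.≤-Reasoning

  enough : suc n ^ k ≤ (2 * suc k) ^ k * length (map fromℕ (upTo (m ^ k)))
  enough = begin
    suc n ^ k                 ≤⟨ ℕ.^-monoˡ-≤ k 1+n≤ ⟩
    (2 * suc k * m) ^ k       ≡⟨ ^-distribʳ-* (2 * suc k) m k ⟩
    (2 * suc k) ^ k * m ^ k   ≡⟨ cong ((2 * suc k) ^ k *_) (trans (length-map fromℕ (upTo (m ^ k))) (length-upTo (m ^ k))) ⟨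
    (2 * suc k) ^ k * length (map fromℕ (upTo (m ^ k))) ∎
    where open ℕ.≤-Reasoning

theorem1p4 : (k : ℕ) →
    (∃[ C ] ∃[ N ] ∀ (n : ℕ) → N ≤ n → (w : Weights n) → NonNeg w →
    ∃[ L ] ((length L ≤ C * n ^ k) ×
    (∀ (c : ℚ) → IsKMincutValue w k c → c ∈ L)))
    ×
    (∃[ C ] ∃[ N ] ∀ (n : ℕ) → N ≤ n →
    Σ[ w ∈ Weights n ] (NonNeg w ×
    ∃[ L ] (Unique L × All (IsKMincutValue w k) L × n ^ k ≤ C * length L)))
theorem1p4 k =
  (1 , 0 , λ n _ w _ → case mincut-values≤ w k of λ { (L , len , complete) →
    L , subst (length L ≤_) (sym (ℕ.*-identityˡ (n ^ k))) len , complete }) ,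
  -- From `k + 2` vertices on, the star has at least `k + 1` leaves, so the base is positive.
  ((2 * suc k) ^ k , k + 2 , many-mincut-values k)
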